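{- For every integer $n\geq 2$, \[ p(n\mid \text{parts}\not\equiv 12,15,27 \pmod{27}) = p(n-1\mid \text{parts}\not\equiv 6,21,27 \pmod{27}) + p(n-2\mid \text{parts}\not\equiv 3,24,27 \pmod{27}). \]
   Context: A partition of a non-negative integer $N$ is a way of writing $N$ as a sum of positive integers (parts), where order of the parts does not matter; the integer $0$ has exactly one partition (the empty one). For integers $a,b,c$ and a modulus $M\geq 1$, $p(N\mid \text{parts}\not\equiv a,b,c \pmod{M})$ denotes the number of partitions of $N$ in which no part is congruent to $a$, $b$, or $c$ modulo $M$. (Note $27\equiv 0 \pmod{27}$, so parts divisible by $27$ are excluded.) -}

module Defs where

open import Data.Nat using (ℕ; zero; suc; _+_; _∸_; _≤_; _≡ᵇ_; _≤ᵇ_)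
open import Data.Nat.DivMod using (_%_)
open import Data.Bool using (Bool; true; false; not; _∧_; _∨_; if_then_else_)
open import Data.List using (List; []; _∷_; length; filter; map; concatMap; upTo; sum)
open import Data.List.Relation.Unary.All using (All)
open import Relation.Nullary.Decidable using (Dec; yes; no)
open import Relation.Binary.PropositionalEquality using (_≡_)

-- partitionsMax k n : all partitions of n whose parts all lie in {1,…,k},
-- each listed once as a non-increasing list of positive parts.
-- Recursion on fuel f ≥ n: the first (largest) part j ranges over 1..min(k,n).
partsAux : ℕ → ℕ → ℕ → List (List ℕ)
partsAux fuel    k zero    = [] ∷ []
partsAux zero    k (suc n) = []
partsAux (suc f) k (suc n) =
  concatMap (λ i → let j = suc i in
                   if j ≤ᵇ k then map (j ∷_) (partsAux f j (suc n ∸ j)) else [])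
            (upTo (suc n))

partitions : ℕ → List (List ℕ)
partitions N = partsAux N N N

allowed27 : ℕ → ℕ → ℕ → ℕ → Bool
allowed27 a b c m =
  not ((m % 27 ≡ᵇ a % 27) ∨ (m % 27 ≡ᵇ b % 27) ∨ (m % 27 ≡ᵇ c % 27))

allAllowed : (ℕ → Bool) → List ℕ → Bool
allAllowed P []       = true
allAllowed P (x ∷ xs) = P x ∧ allAllowed P xs

p27 : ℕ → ℕ → ℕ → ℕ → ℕ
p27 N a b c = length (filter (λ λs → Data.Bool._≟_ (allAllowed (allowed27 a b c) λs) true) (partitions N))

{-# OPTIONS --safe #-}

-- After multiplication by (q;q)_∞, the generating function of the partitions
-- with no part ≡ a, 27-a, 0 (mod 27) becomes (q^a, q^(27-a), q^27; q^27)_∞,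
-- which by the Jacobi triple product is the theta series
-- Σ_k (-1)^k q^(27k(k-1)/2 + ak).  Likewise (q;q)_∞ = (q, q^2, q^3; q^3)_∞ is
-- the pentagonal number series, and sorting its terms by k mod 3 expresses it
-- through the theta series with a = 12, 21, 3:  Θ₁₂ - q Θ₂₁ - q² Θ₃ = (q;q)_∞.
-- Dividing by (q;q)_∞ gives A = 1 + q B + q² C for the three generating
-- functions.  Infinite products are avoided by working modulo powers of q with
-- the finite triple product, whose coefficients [2n,n+k]_Q tend to 1/(Q;Q)_∞.
module Submission where

open import Defs
open import Algebra.Bundles using (CommutativeRing)
import Algebra.Construct.Pointwise as Pointwise
open import Data.Bool using (Bool; true; false; if_then_else_; not; _∨_; _≟_)
import Data.Bool.Properties as Boolₚ
open import Data.Integer as ℤ using (ℤ; +_; 0ℤ; 1ℤ)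
import Data.Integer.Properties as ℤₚ
import Data.Integer.Tactic.RingSolver as ℤ-Solver
open import Data.List as List using (List; []; _∷_; _++_; length; filter; concatMap; applyUpTo; upTo)
import Data.List.Properties as Listₚ
open import Data.Nat as ℕ using (ℕ; zero; suc; _≤_; _<_; z≤n; s≤s; _≤ᵇ_; _<ᵇ_; _≡ᵇ_)
open import Data.Nat.DivMod using (_%_; [m+kn]%n≡m%n)
open import Data.Nat.ListAction using (sum)
import Data.Nat.Properties as ℕₚ
open import Data.Nat.Tactic.RingSolver using (solve-∀)
open import Data.Product using (_,_)
open import Function using (_∘_)
open import Level using (0ℓ; _⊔_)
open import Relation.Binary.PropositionalEquality as ≡ using (_≡_)

-- Triangular numbers and the exponents of theta series

T : ℕ → ℕ
T zero    = 0
T (suc n) = n ℕ.+ T n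

-- θ-exp a b n s is (a + b) k (k - 1) / 2 + a k for the integer k = s - n.
θ-exp : ℕ → ℕ → ℕ → ℕ → ℕ
θ-exp a b zero    s       = a ℕ.* s ℕ.+ (a ℕ.+ b) ℕ.* T s
θ-exp a b (suc n) zero    = b ℕ.* suc n ℕ.+ (a ℕ.+ b) ℕ.* T (suc n)
θ-exp a b (suc n) (suc s) = θ-exp a b n s

-- For k = s - n and M = a + b, the exponents at k and k - 1 differ by M k - b = M (s - n) - b; the
-- terms are distributed so that nothing is subtracted.
θ-exp-suc : ∀ a b n s →
  θ-exp a b n s ℕ.+ (b ℕ.+ (a ℕ.+ b) ℕ.* n) ≡ θ-exp a b (suc n) s ℕ.+ (a ℕ.+ b) ℕ.* s
θ-exp-suc a b zero zero = lemma a b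
  where
  lemma : ∀ a b → a ℕ.* 0 ℕ.+ (a ℕ.+ b) ℕ.* 0 ℕ.+ (b ℕ.+ (a ℕ.+ b) ℕ.* 0)
                ≡ b ℕ.* 1 ℕ.+ (a ℕ.+ b) ℕ.* 0 ℕ.+ (a ℕ.+ b) ℕ.* 0
  lemma = solve-∀
θ-exp-suc a b zero (suc s) = lemma a b s (T s)
  where
  lemma : ∀ a b s t →
    a ℕ.* suc s ℕ.+ (a ℕ.+ b) ℕ.* (s ℕ.+ t) ℕ.+ (b ℕ.+ (a ℕ.+ b) ℕ.* 0)
      ≡ a ℕ.* s ℕ.+ (a ℕ.+ b) ℕ.* t ℕ.+ (a ℕ.+ b) ℕ.* suc s
  lemma = solve-∀
θ-exp-suc a b (suc n) zero = lemma a b n (T n)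
  where
  lemma : ∀ a b n t →
    b ℕ.* suc n ℕ.+ (a ℕ.+ b) ℕ.* (n ℕ.+ t) ℕ.+ (b ℕ.+ (a ℕ.+ b) ℕ.* suc n)
      ≡ b ℕ.* suc (suc n) ℕ.+ (a ℕ.+ b) ℕ.* (suc n ℕ.+ (n ℕ.+ t)) ℕ.+ (a ℕ.+ b) ℕ.* 0
  lemma = solve-∀
θ-exp-suc a b (suc n) (suc s) = begin
  e ℕ.+ (b ℕ.+ M ℕ.* suc n)         ≡⟨ lemma₁ e b M n ⟩
  e ℕ.+ (b ℕ.+ M ℕ.* n) ℕ.+ M       ≡⟨ ≡.cong (ℕ._+ M) (θ-exp-suc a b n s) ⟩
  e′ ℕ.+ M ℕ.* s ℕ.+ M              ≡⟨ lemma₂ e′ M s ⟩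
  e′ ℕ.+ M ℕ.* suc s                ∎
  where
  open ≡.≡-Reasoning
  M  = a ℕ.+ b
  e  = θ-exp a b n s
  e′ = θ-exp a b (suc n) s
  lemma₁ : ∀ e b M n → e ℕ.+ (b ℕ.+ M ℕ.* suc n) ≡ e ℕ.+ (b ℕ.+ M ℕ.* n) ℕ.+ M
  lemma₁ = solve-∀
  lemma₂ : ∀ e M s → e ℕ.+ M ℕ.* s ℕ.+ M ≡ e ℕ.+ M ℕ.* suc s
  lemma₂ = solve-∀

n≤m*n : ∀ {m} n → 1 ≤ m → n ≤ m ℕ.* n
n≤m*n {m} n 1≤m = ≡.subst (_≤ m ℕ.* n) (ℕₚ.*-identityˡ n) (ℕₚ.*-monoˡ-≤ n {1} 1≤m)

-- With the next lemma this bounds the exponent at k = s - n below by |k|, which pays for the loss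
-- of precision of q-binomials away from the centre.
θ-exp-lower : ∀ {a b} → 1 ≤ b → ∀ n s → n ≤ θ-exp a b n s ℕ.+ s
θ-exp-lower 1≤b zero    s       = z≤n
θ-exp-lower 1≤b (suc n) zero    =
  ℕₚ.m≤n⇒m≤n+o 0 (ℕₚ.m≤n⇒m≤n+o _ (n≤m*n (suc n) 1≤b))
θ-exp-lower 1≤b (suc n) (suc s) =
  ≡.subst (suc n ≤_) (≡.sym (ℕₚ.+-suc _ s)) (s≤s (θ-exp-lower 1≤b n s))

θ-exp-upper : ∀ {a b} → 1 ≤ a → ∀ n s → s ≤ θ-exp a b n s ℕ.+ n
θ-exp-upper 1≤a zero    s       =
  ℕₚ.m≤n⇒m≤n+o 0 (ℕₚ.m≤n⇒m≤n+o _ (n≤m*n s 1≤a))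
θ-exp-upper 1≤a (suc n) zero    = z≤n
θ-exp-upper 1≤a (suc n) (suc s) =
  ≡.subst (suc s ≤_) (≡.sym (ℕₚ.+-suc _ n)) (s≤s (θ-exp-upper 1≤a n s))

-- Recursion in place of `3 * n` lets `θ-exp`, `sgn` and `∑` reduce through three successors at a
-- time.
triple : ℕ → ℕ
triple zero    = zero
triple (suc n) = suc (suc (suc (triple n)))

triple≡3* : ∀ n → triple n ≡ 3 ℕ.* n
triple≡3* zero    = ≡.refl
triple≡3* (suc n) = ≡.trans (≡.cong (3 ℕ.+_) (triple≡3* n)) (≡.sym (ℕₚ.*-suc 3 n))

T-triple : ∀ n → T (triple n) ≡ 9 ℕ.* T n ℕ.+ 3 ℕ.* n
T-triple zero    = ≡.refl
T-triple (suc n) rewrite T-triple n | triple≡3* n = lemma n (T n)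
  where
  lemma : ∀ n t → suc (suc (3 ℕ.* n)) ℕ.+ (suc (3 ℕ.* n) ℕ.+ (3 ℕ.* n ℕ.+ (9 ℕ.* t ℕ.+ 3 ℕ.* n)))
                ≡ 9 ℕ.* (n ℕ.+ t) ℕ.+ 3 ℕ.* suc n
  lemma = solve-∀

-- For m = k - n, the pentagonal exponent j(3j - 1)/2 at j = 3m - 1 is 27m(m - 1)/2 + 3m + 2. The
-- next two lemmas treat j = 3m and j = 3m + 1, with one successor already cancelled from both
-- arguments.
θ-exp-3k : ∀ n k → θ-exp 1 2 (suc (triple n)) (triple k) ≡ 2 ℕ.+ θ-exp 3 24 n k
θ-exp-3k zero zero = ≡.refl
θ-exp-3k zero (suc k) rewrite T-triple k | triple≡3* k = lemma k (T k)
  where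
  lemma : ∀ k t →
    1 ℕ.* suc (suc (3 ℕ.* k)) ℕ.+ 3 ℕ.* (suc (3 ℕ.* k) ℕ.+ (3 ℕ.* k ℕ.+ (9 ℕ.* t ℕ.+ 3 ℕ.* k)))
      ≡ 2 ℕ.+ (3 ℕ.* suc k ℕ.+ 27 ℕ.* (k ℕ.+ t))
  lemma = solve-∀
θ-exp-3k (suc n) zero rewrite T-triple n | triple≡3* n = lemma n (T n)
  where
  lemma : ∀ n t → let m = 3 ℕ.* n in
    2 ℕ.* suc (suc (suc (suc m)))
      ℕ.+ 3 ℕ.* (suc (suc (suc m)) ℕ.+ (suc (suc m) ℕ.+ (suc m ℕ.+ (m ℕ.+ (9 ℕ.* t ℕ.+ m)))))
      ≡ 2 ℕ.+ (24 ℕ.* suc n ℕ.+ 27 ℕ.* (n ℕ.+ t))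
  lemma = solve-∀
θ-exp-3k (suc n) (suc k) = θ-exp-3k n k

θ-exp-3k+1 : ∀ n k → θ-exp 1 2 (triple n) (triple k) ≡ θ-exp 12 15 n k
θ-exp-3k+1 zero k rewrite T-triple k | triple≡3* k = lemma k (T k)
  where
  lemma : ∀ k t → 1 ℕ.* (3 ℕ.* k) ℕ.+ 3 ℕ.* (9 ℕ.* t ℕ.+ 3 ℕ.* k) ≡ 12 ℕ.* k ℕ.+ 27 ℕ.* t
  lemma = solve-∀
θ-exp-3k+1 (suc n) zero rewrite T-triple n | triple≡3* n = lemma n (T n)
  where
  lemma : ∀ n t → let m = 3 ℕ.* n in
    2 ℕ.* suc (suc (suc m)) ℕ.+ 3 ℕ.* (suc (suc m) ℕ.+ (suc m ℕ.+ (m ℕ.+ (9 ℕ.* t ℕ.+ m))))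
      ≡ 15 ℕ.* suc n ℕ.+ 27 ℕ.* (n ℕ.+ t)
  lemma = solve-∀
θ-exp-3k+1 (suc n) (suc k) = θ-exp-3k+1 n k

θ-exp-3k+2 : ∀ n k → θ-exp 1 2 (triple n) (suc (triple k)) ≡ 1 ℕ.+ θ-exp 21 6 n k
θ-exp-3k+2 zero k rewrite T-triple k | triple≡3* k = lemma k (T k)
  where
  lemma : ∀ k t →
    1 ℕ.* suc (3 ℕ.* k) ℕ.+ 3 ℕ.* (3 ℕ.* k ℕ.+ (9 ℕ.* t ℕ.+ 3 ℕ.* k)) ≡ 1 ℕ.+ (21 ℕ.* k ℕ.+ 27 ℕ.* t)
  lemma = solve-∀
θ-exp-3k+2 (suc n) zero rewrite T-triple n | triple≡3* n = lemma n (T n)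
  where
  lemma : ∀ n t → let m = 3 ℕ.* n in
    2 ℕ.* suc (suc m) ℕ.+ 3 ℕ.* (suc m ℕ.+ (m ℕ.+ (9 ℕ.* t ℕ.+ m)))
      ≡ 1 ℕ.+ (6 ℕ.* suc n ℕ.+ 27 ℕ.* (n ℕ.+ t))
  lemma = solve-∀
θ-exp-3k+2 (suc n) (suc k) = θ-exp-3k+2 n k

-- The centre 3n + 1 gives 2(3n + 1) + 1 = 3(2n + 1) terms, which fall into exact triples.
triple-double : ∀ n → suc (suc (triple n) ℕ.+ suc (triple n)) ≡ triple (suc (n ℕ.+ n))
triple-double n rewrite triple≡3* n | triple≡3* (n ℕ.+ n) = lemma n
  where
  lemma : ∀ n → suc (suc (3 ℕ.* n) ℕ.+ suc (3 ℕ.* n)) ≡ suc (suc (suc (3 ℕ.* (n ℕ.+ n))))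
  lemma = solve-∀

module JacobiTripleProduct {c ℓ} (R : CommutativeRing c ℓ) (q : CommutativeRing.Carrier R) where

  open CommutativeRing R
  open import Algebra.Properties.Semiring.Exp semiring
  open import Algebra.Properties.Ring ring using (-1*x≈-x; -‿distribʳ-*)
  open import Algebra.Properties.AbelianGroup +-abelianGroup using (⁻¹-involutive)
  open import Algebra.Solver.Ring.NaturalCoefficients.Default commutativeSemiring
    using (solve; _:=_; _:+_; _:*_; con)
  open import Relation.Binary.Reasoning.Setoid setoid

  -- Finite sums, q-Pochhammer symbols and q-binomial coefficients

  ∑ : ℕ → (ℕ → Carrier) → Carrier
  ∑ zero    f = 0#
  ∑ (suc n) f = ∑ n f + f n

  ∑-cong : ∀ n {f g} → (∀ i → f i ≈ g i) → ∑ n f ≈ ∑ n g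
  ∑-cong zero    f≈g = refl
  ∑-cong (suc n) f≈g = +-cong (∑-cong n f≈g) (f≈g n)

  ∑-+ : ∀ n f g → ∑ n (λ i → f i + g i) ≈ ∑ n f + ∑ n g
  ∑-+ zero    f g = sym (+-identityˡ 0#)
  ∑-+ (suc n) f g = trans (+-congʳ (∑-+ n f g))
    (solve 4 (λ a b c d → (a :+ b) :+ (c :+ d) := (a :+ c) :+ (b :+ d)) refl
      (∑ n f) (∑ n g) (f n) (g n))

  ∑-*ˡ : ∀ n x f → x * ∑ n f ≈ ∑ n (λ i → x * f i)
  ∑-*ˡ zero    x f = zeroʳ x
  ∑-*ˡ (suc n) x f = trans (distribˡ x _ _) (+-congʳ (∑-*ˡ n x f))

  ∑-front : ∀ n f → ∑ (suc n) f ≈ f 0 + ∑ n (λ i → f (suc i))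
  ∑-front zero    f = +-comm 0# (f 0)
  ∑-front (suc n) f = trans (+-congʳ (∑-front n f)) (+-assoc _ _ _)

  -- The q-Pochhammer symbol (q^e; q^M)_n.
  poch : ℕ → ℕ → ℕ → Carrier
  poch e M zero    = 1#
  poch e M (suc n) = poch e M n * (1# - q ^ (e ℕ.+ M ℕ.* n))

  factor-cong : ∀ {m n} → m ≡ n → 1# - q ^ m ≈ 1# - q ^ n
  factor-cong m≡n = reflexive (≡.cong (λ k → 1# - q ^ k) m≡n)

  poch-front : ∀ e M n → poch e M (suc n) ≈ (1# - q ^ e) * poch (e ℕ.+ M) M n
  poch-front e M zero    = begin
    1# * (1# - q ^ (e ℕ.+ M ℕ.* 0)) ≈⟨ *-congˡ (factor-cong (lemma e M)) ⟩
    1# * (1# - q ^ e)               ≈⟨ *-comm _ _ ⟩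
    (1# - q ^ e) * 1#               ∎
    where
    lemma : ∀ e M → e ℕ.+ M ℕ.* 0 ≡ e
    lemma = solve-∀
  poch-front e M (suc n) = begin
    poch e M (suc n) * (1# - q ^ (e ℕ.+ M ℕ.* suc n))
      ≈⟨ *-cong (poch-front e M n) (factor-cong (lemma e M n)) ⟩
    (1# - q ^ e) * poch (e ℕ.+ M) M n * (1# - q ^ (e ℕ.+ M ℕ.+ M ℕ.* n))
      ≈⟨ *-assoc _ _ _ ⟩
    (1# - q ^ e) * poch (e ℕ.+ M) M (suc n) ∎
    where
    lemma : ∀ e M n → e ℕ.+ M ℕ.* suc n ≡ e ℕ.+ M ℕ.+ M ℕ.* n
    lemma = solve-∀

  poch-+ : ∀ M m n → poch M M (m ℕ.+ n) ≈ poch M M m * poch (M ℕ.* suc m) M n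
  poch-+ M m zero = trans (reflexive (≡.cong (poch M M) (ℕₚ.+-identityʳ m))) (sym (*-identityʳ _))
  poch-+ M m (suc n) = begin
    poch M M (m ℕ.+ suc n)
      ≡⟨ ≡.cong (poch M M) (ℕₚ.+-suc m n) ⟩
    poch M M (m ℕ.+ n) * (1# - q ^ (M ℕ.+ M ℕ.* (m ℕ.+ n)))
      ≈⟨ *-cong (poch-+ M m n) (factor-cong (lemma M m n)) ⟩
    poch M M m * poch (M ℕ.* suc m) M n * (1# - q ^ (M ℕ.* suc m ℕ.+ M ℕ.* n))
      ≈⟨ *-assoc _ _ _ ⟩
    poch M M m * poch (M ℕ.* suc m) M (suc n) ∎
    where
    lemma : ∀ M m n → M ℕ.+ M ℕ.* (m ℕ.+ n) ≡ M ℕ.* suc m ℕ.+ M ℕ.* n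
    lemma = solve-∀

  -- The Gaussian binomial coefficient in Q = q^M, defined by Pascal's recurrence to avoid division.
  qbinom : ℕ → ℕ → ℕ → Carrier
  qbinom M n       zero    = 1#
  qbinom M zero    (suc k) = 0#
  qbinom M (suc n) (suc k) = qbinom M n k + q ^ (M ℕ.* suc k) * qbinom M n (suc k)

  qbinom-vanish : ∀ M n k → n < k → qbinom M n k ≈ 0#
  qbinom-vanish M zero    (suc k) _         = refl
  qbinom-vanish M (suc n) (suc k) (s≤s n<k) = begin
    qbinom M n k + q ^ (M ℕ.* suc k) * qbinom M n (suc k)
      ≈⟨ +-cong (qbinom-vanish M n k n<k)
                (*-congˡ (qbinom-vanish M n (suc k) (ℕₚ.m<n⇒m<1+n n<k))) ⟩
    0# + q ^ (M ℕ.* suc k) * 0#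
      ≈⟨ trans (+-identityˡ _) (zeroʳ _) ⟩
    0# ∎

  qbinom-diagonal : ∀ M n → qbinom M n n ≈ 1#
  qbinom-diagonal M zero    = refl
  qbinom-diagonal M (suc n) = begin
    qbinom M n n + q ^ (M ℕ.* suc n) * qbinom M n (suc n)
      ≈⟨ +-cong (qbinom-diagonal M n) (*-congˡ (qbinom-vanish M n (suc n) (ℕₚ.n<1+n n))) ⟩
    1# + q ^ (M ℕ.* suc n) * 0#
      ≈⟨ trans (+-congˡ (zeroʳ _)) (+-identityʳ _) ⟩
    1# ∎

  telescope : ∀ x y → (1# - x) + x * (1# - y) ≈ 1# - x * y
  telescope x y = begin
    (1# - x) + x * (1# - y)
      ≈⟨ solve 4 (λ i x nx ny → (i :+ nx) :+ x :* (i :+ ny) := (i :+ x :* ny) :+ (nx :+ x :* i)) refl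
           1# x (- x) (- y) ⟩
    (1# + x * - y) + (- x + x * 1#)
      ≈⟨ +-cong (+-congˡ (sym (-‿distribʳ-* x y)))
                (trans (+-congˡ (*-identityʳ x)) (-‿inverseˡ x)) ⟩
    (1# - x * y) + 0#
      ≈⟨ +-identityʳ _ ⟩
    1# - x * y ∎

  -- The factorial formula for q-binomials with denominators cleared. Pascal's recurrence leads from
  -- (s + 1, r + 1) to (s, r + 1) and (s + 1, r), whose contributions combine by `telescope`.
  poch*qbinom : ∀ M s r → poch M M s * qbinom M (s ℕ.+ r) s ≈ poch (M ℕ.* suc r) M s
  poch*qbinom M zero    r       = *-identityˡ 1#
  poch*qbinom M (suc s) zero    = begin
    poch M M (suc s) * qbinom M (suc s ℕ.+ 0) (suc s)
      ≡⟨ ≡.cong (λ k → poch M M (suc s) * qbinom M k (suc s)) (ℕₚ.+-identityʳ (suc s)) ⟩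
    poch M M (suc s) * qbinom M (suc s) (suc s)
      ≈⟨ trans (*-congˡ (qbinom-diagonal M (suc s))) (*-identityʳ _) ⟩
    poch M M (suc s)
      ≡⟨ ≡.cong (λ k → poch k M (suc s)) (≡.sym (ℕₚ.*-identityʳ M)) ⟩
    poch (M ℕ.* 1) M (suc s) ∎
  poch*qbinom M (suc s) (suc r) = begin
    (poch M M s * (1# - q ^ (M ℕ.+ M ℕ.* s))) * (qbinom M (s ℕ.+ suc r) s + x * B)
      ≈⟨ *-congʳ (*-congˡ (factor-cong (≡.sym (ℕₚ.*-suc M s)))) ⟩
    (poch M M s * (1# - x)) * (qbinom M (s ℕ.+ suc r) s + x * B)
      ≈⟨ solve 5 (λ p f b x b′ → (p :* f) :* (b :+ x :* b′) := f :* (p :* b) :+ x :* ((p :* f) :* b′)) refl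
           (poch M M s) (1# - x) (qbinom M (s ℕ.+ suc r) s) x B ⟩
    (1# - x) * (poch M M s * qbinom M (s ℕ.+ suc r) s) + x * ((poch M M s * (1# - x)) * B)
      ≈⟨ +-cong (*-congˡ (poch*qbinom M s (suc r))) (*-congˡ second) ⟩
    (1# - x) * P + x * ((1# - y) * P)
      ≈⟨ solve 4 (λ f x g p → f :* p :+ x :* (g :* p) := p :* (f :+ x :* g)) refl
           (1# - x) x (1# - y) P ⟩
    P * ((1# - x) + x * (1# - y))
      ≈⟨ *-congˡ (telescope x y) ⟩
    P * (1# - x * y)
      ≈⟨ *-congˡ (+-congˡ (-‿cong (sym (^-homo-* q (M ℕ.* suc s) (M ℕ.* suc r))))) ⟩
    P * (1# - q ^ (M ℕ.* suc s ℕ.+ M ℕ.* suc r))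
      ≈⟨ *-congˡ (factor-cong (lemma M s r)) ⟩
    P * (1# - q ^ (M ℕ.* suc (suc r) ℕ.+ M ℕ.* s)) ∎
    where
    x = q ^ (M ℕ.* suc s)
    y = q ^ (M ℕ.* suc r)
    B = qbinom M (s ℕ.+ suc r) (suc s)
    P = poch (M ℕ.* suc (suc r)) M s
    lemma : ∀ M s r → M ℕ.* suc s ℕ.+ M ℕ.* suc r ≡ M ℕ.* suc (suc r) ℕ.+ M ℕ.* s
    lemma = solve-∀
    lemma₂ : ∀ M r → M ℕ.* suc r ℕ.+ M ≡ M ℕ.* suc (suc r)
    lemma₂ = solve-∀
    second : (poch M M s * (1# - x)) * B ≈ (1# - y) * P
    second = begin
      (poch M M s * (1# - x)) * B
        ≈⟨ *-congʳ (*-congˡ (factor-cong (ℕₚ.*-suc M s))) ⟩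
      poch M M (suc s) * B
        ≡⟨ ≡.cong (λ k → poch M M (suc s) * qbinom M k (suc s)) (ℕₚ.+-suc s r) ⟩
      poch M M (suc s) * qbinom M (suc s ℕ.+ r) (suc s)
        ≈⟨ poch*qbinom M (suc s) r ⟩
      poch (M ℕ.* suc r) M (suc s)
        ≈⟨ poch-front (M ℕ.* suc r) M s ⟩
      (1# - y) * poch (M ℕ.* suc r ℕ.+ M) M s
        ≡⟨ ≡.cong (λ k → (1# - y) * poch k M s) (lemma₂ M r) ⟩
      (1# - y) * P ∎

  -- One more factor 1 - w splits each term in two, and the halves recombine by
  -- Pascal's recurrence; both the q-binomial theorem and the passage from n to
  -- n + 1 in the triple product are of this form.
  ∑-pascal : ∀ M N w (u v : ℕ → Carrier) →
    (∀ s → u s + u s * - w ≈ v (suc s) + v s * q ^ (M ℕ.* s)) →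
    ∑ (suc N) (λ s → u s * qbinom M N s) * (1# - w)
      ≈ ∑ (suc (suc N)) (λ s → v s * qbinom M (suc N) s)
  ∑-pascal M N w u v step = begin
    ∑ (suc N) (λ s → u s * B s) * (1# - w)
      ≈⟨ trans (*-comm _ _) (∑-*ˡ (suc N) _ _) ⟩
    ∑ (suc N) (λ s → (1# - w) * (u s * B s))
      ≈⟨ ∑-cong (suc N) (λ s → trans
           (solve 3 (λ u w b → (con 1 :+ w) :* (u :* b) := (u :+ u :* w) :* b) refl (u s) (- w) (B s))
           (trans (*-congʳ (step s)) (distribʳ _ _ _))) ⟩
    ∑ (suc N) (λ s → v (suc s) * B s + v s * q ^ (M ℕ.* s) * B s)
      ≈⟨ ∑-+ (suc N) _ _ ⟩
    ∑ (suc N) (λ s → v (suc s) * B s) + ∑ (suc N) g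
      ≈⟨ +-congˡ (sym (+-identityʳ _)) ⟩
    ∑ (suc N) (λ s → v (suc s) * B s) + (∑ (suc N) g + 0#)
      -- The extra term s = N + 1 vanishes; with it the second sum can be reindexed from its front.
      ≈⟨ +-congˡ (+-congˡ (sym (trans (*-congˡ (qbinom-vanish M N (suc N) (ℕₚ.n<1+n N))) (zeroʳ _)))) ⟩
    ∑ (suc N) (λ s → v (suc s) * B s) + ∑ (suc (suc N)) g
      ≈⟨ +-congˡ (∑-front (suc N) g) ⟩
    ∑ (suc N) (λ s → v (suc s) * B s) + (g 0 + ∑ (suc N) (λ s → g (suc s)))
      ≈⟨ solve 3 (λ a b c → a :+ (b :+ c) := b :+ (a :+ c)) refl _ _ _ ⟩
    g 0 + (∑ (suc N) (λ s → v (suc s) * B s) + ∑ (suc N) (λ s → g (suc s)))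
      ≈⟨ +-cong g0 (sym (∑-+ (suc N) _ _)) ⟩
    v 0 * 1# + ∑ (suc N) (λ s → v (suc s) * B s + g (suc s))
      ≈⟨ +-congˡ (∑-cong (suc N) (λ s →
           solve 4 (λ v b x b′ → v :* b :+ v :* x :* b′ := v :* (b :+ x :* b′)) refl
             (v (suc s)) (B s) (q ^ (M ℕ.* suc s)) (B (suc s)))) ⟩
    v 0 * 1# + ∑ (suc N) (λ s → v (suc s) * qbinom M (suc N) (suc s))
      ≈⟨ sym (∑-front (suc N) _) ⟩
    ∑ (suc (suc N)) (λ s → v s * qbinom M (suc N) s) ∎
    where
    B : ℕ → Carrier
    B = qbinom M N
    g : ℕ → Carrier
    g s = v s * q ^ (M ℕ.* s) * B s
    g0 : g 0 ≈ v 0 * 1#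
    g0 = trans (*-identityʳ _)
      (*-congˡ (reflexive (≡.cong (q ^_) (ℕₚ.*-zeroʳ M))))

  -- Signs, the q-binomial theorem and the finite triple product

  ε : ℕ → Carrier
  ε zero    = 1#
  ε (suc n) = - 1# * ε n

  -- The sign (-1) ^ (s - n).
  sgn : ℕ → ℕ → Carrier
  sgn zero    s       = ε s
  sgn (suc n) zero    = ε (suc n)
  sgn (suc n) (suc s) = sgn n s

  -1*-1* : ∀ x → - 1# * (- 1# * x) ≈ x
  -1*-1* x = trans (-1*x≈-x _) (trans (-‿cong (-1*x≈-x x)) (⁻¹-involutive x))

  sgn-suc : ∀ n s → sgn (suc n) s ≈ - 1# * sgn n s
  sgn-suc zero    zero    = refl
  sgn-suc zero    (suc s) = sym (-1*-1* (ε s))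
  sgn-suc (suc n) zero    = refl
  sgn-suc (suc n) (suc s) = sgn-suc n s

  signed*neg : ∀ x m n → x * q ^ m * - (q ^ n) ≈ - 1# * x * q ^ (m ℕ.+ n)
  signed*neg x m n = begin
    x * q ^ m * - (q ^ n)          ≈⟨ *-congˡ (sym (-1*x≈-x _)) ⟩
    x * q ^ m * (- 1# * q ^ n)     ≈⟨ solve 4 (λ x a i b → x :* a :* (i :* b) := i :* x :* (a :* b)) refl
                                        x (q ^ m) (- 1#) (q ^ n) ⟩
    - 1# * x * (q ^ m * q ^ n)     ≈⟨ *-congˡ (sym (^-homo-* q m n)) ⟩
    - 1# * x * q ^ (m ℕ.+ n)       ∎

  -- Gauss's expansion, with Q = q^M. The first factor is split off, not the last: the rest starts
  -- at a + M, and its terms are those for a times Q^s, as Pascal's recurrence requires.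
  q-binomial-theorem : ∀ M m a →
    poch a M m ≈ ∑ (suc m) (λ s → ε s * q ^ (a ℕ.* s ℕ.+ M ℕ.* T s) * qbinom M m s)
  q-binomial-theorem M zero a = sym (begin
    0# + 1# * q ^ (a ℕ.* 0 ℕ.+ M ℕ.* 0) * 1#
      ≡⟨ ≡.cong (λ k → 0# + 1# * q ^ k * 1#) (lemma a M) ⟩
    0# + 1# * 1# * 1#
      ≈⟨ solve 0 (con 0 :+ con 1 :* con 1 :* con 1 := con 1) refl ⟩
    1# ∎)
    where
    lemma : ∀ a M → a ℕ.* 0 ℕ.+ M ℕ.* 0 ≡ 0
    lemma = solve-∀
  q-binomial-theorem M (suc m) a = begin
    poch a M (suc m)
      ≈⟨ trans (poch-front a M m) (*-comm _ _) ⟩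
    poch (a ℕ.+ M) M m * (1# - q ^ a)
      ≈⟨ *-congʳ (q-binomial-theorem M m (a ℕ.+ M)) ⟩
    ∑ (suc m) (λ s → u s * qbinom M m s) * (1# - q ^ a)
      ≈⟨ ∑-pascal M m (q ^ a) u v step ⟩
    ∑ (suc (suc m)) (λ s → v s * qbinom M (suc m) s) ∎
    where
    u v : ℕ → Carrier
    u s = ε s * q ^ ((a ℕ.+ M) ℕ.* s ℕ.+ M ℕ.* T s)
    v s = ε s * q ^ (a ℕ.* s ℕ.+ M ℕ.* T s)
    lemma₁ : ∀ a M s t → (a ℕ.+ M) ℕ.* s ℕ.+ M ℕ.* t ≡ a ℕ.* s ℕ.+ M ℕ.* t ℕ.+ M ℕ.* s
    lemma₁ = solve-∀
    lemma₂ : ∀ a M s t → (a ℕ.+ M) ℕ.* s ℕ.+ M ℕ.* t ℕ.+ a ≡ a ℕ.* suc s ℕ.+ M ℕ.* (s ℕ.+ t)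
    lemma₂ = solve-∀
    step : ∀ s → u s + u s * - (q ^ a) ≈ v (suc s) + v s * q ^ (M ℕ.* s)
    step s = trans (+-comm _ _) (+-cong
      (trans (signed*neg (ε s) ((a ℕ.+ M) ℕ.* s ℕ.+ M ℕ.* T s) a)
             (*-congˡ (^-congʳ q (lemma₂ a M s (T s)))))
      (trans (*-congˡ (trans (^-congʳ q (lemma₁ a M s (T s)))
               (^-homo-* q (a ℕ.* s ℕ.+ M ℕ.* T s) (M ℕ.* s))))
             (sym (*-assoc _ _ _))))

  -- Induction on the length of the second product: each new factor moves the centre by one,
  -- starting from the q-binomial theorem.
  finite-triple-product : ∀ a b m n → let M = a ℕ.+ b in
    poch a M m * poch b M n
      ≈ ∑ (suc (n ℕ.+ m)) (λ s → sgn n s * q ^ θ-exp a b n s * qbinom M (n ℕ.+ m) s)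
  finite-triple-product a b m zero    =
    trans (*-identityʳ _) (q-binomial-theorem (a ℕ.+ b) m a)
  finite-triple-product a b m (suc n) = begin
    poch a M m * (poch b M n * (1# - w))
      ≈⟨ sym (*-assoc _ _ _) ⟩
    poch a M m * poch b M n * (1# - w)
      ≈⟨ *-congʳ (finite-triple-product a b m n) ⟩
    ∑ (suc (n ℕ.+ m)) (λ s → u s * qbinom M (n ℕ.+ m) s) * (1# - w)
      ≈⟨ ∑-pascal M (n ℕ.+ m) w u v step ⟩
    ∑ (suc (suc (n ℕ.+ m))) (λ s → v s * qbinom M (suc (n ℕ.+ m)) s) ∎
    where
    M = a ℕ.+ b
    w = q ^ (b ℕ.+ M ℕ.* n)
    u v : ℕ → Carrier
    u s = sgn n s * q ^ θ-exp a b n s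
    v s = sgn (suc n) s * q ^ θ-exp a b (suc n) s
    step : ∀ s → u s + u s * - w ≈ v (suc s) + v s * q ^ (M ℕ.* s)
    -- `u s` and `v (suc s)` agree by definition, as `sgn` and `θ-exp` drop a successor from both
    -- arguments.
    step s = +-congˡ (begin
      u s * - w
        ≈⟨ signed*neg (sgn n s) (θ-exp a b n s) (b ℕ.+ M ℕ.* n) ⟩
      - 1# * sgn n s * q ^ (θ-exp a b n s ℕ.+ (b ℕ.+ M ℕ.* n))
        ≈⟨ *-cong (sym (sgn-suc n s)) (trans (^-congʳ q (θ-exp-suc a b n s))
                                     (^-homo-* q (θ-exp a b (suc n) s) (M ℕ.* s))) ⟩
      sgn (suc n) s * (q ^ θ-exp a b (suc n) s * q ^ (M ℕ.* s))
        ≈⟨ sym (*-assoc _ _ _) ⟩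
      v s * q ^ (M ℕ.* s) ∎)

  -- Congruence modulo powers of q

  infix 4 _≈_[q^_]

  record _≈_[q^_] (x y : Carrier) (k : ℕ) : Set (c ⊔ ℓ) where
    constructor by
    field
      quotient : Carrier
      equality : x ≈ y + q ^ k * quotient

  ≈⇒≈[] : ∀ {k x y} → x ≈ y → x ≈ y [q^ k ]
  ≈⇒≈[] {k} {x} {y} x≈y =
    by 0# (trans x≈y (sym (trans (+-congˡ (zeroʳ _)) (+-identityʳ y))))

  ≈[]-trans : ∀ {k x y z} → x ≈ y [q^ k ] → y ≈ z [q^ k ] → x ≈ z [q^ k ]
  ≈[]-trans {k} {x} {y} {z} (by u x≈) (by v y≈) = by (u + v) (begin
    x                             ≈⟨ trans x≈ (+-congʳ y≈) ⟩
    z + q ^ k * v + q ^ k * u     ≈⟨ solve 4 (λ z p u v → z :+ p :* v :+ p :* u := z :+ p :* (u :+ v)) refl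
                                       z (q ^ k) u v ⟩
    z + q ^ k * (u + v)           ∎)

  ≈[]-sym : ∀ {k x y} → x ≈ y [q^ k ] → y ≈ x [q^ k ]
  ≈[]-sym {k} {x} {y} (by u x≈) = by (- u) (sym (begin
    x + q ^ k * - u                   ≈⟨ +-cong x≈ (sym (-‿distribʳ-* (q ^ k) u)) ⟩
    y + q ^ k * u + - (q ^ k * u)     ≈⟨ +-assoc _ _ _ ⟩
    y + (q ^ k * u + - (q ^ k * u))   ≈⟨ trans (+-congˡ (-‿inverseʳ _)) (+-identityʳ y) ⟩
    y                                 ∎))

  ≈[]-+ : ∀ {k x y x′ y′} → x ≈ y [q^ k ] → x′ ≈ y′ [q^ k ] → x + x′ ≈ y + y′ [q^ k ]
  ≈[]-+ {k} {x} {y} {x′} {y′} (by u x≈) (by v x′≈) = by (u + v) (trans (+-cong x≈ x′≈)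
    (solve 5 (λ y y′ p u v → y :+ p :* u :+ (y′ :+ p :* v) := y :+ y′ :+ p :* (u :+ v)) refl
      y y′ (q ^ k) u v))

  ≈[]-*ˡ : ∀ {k x y} w → x ≈ y [q^ k ] → w * x ≈ w * y [q^ k ]
  ≈[]-*ˡ {k} {x} {y} w (by u x≈) = by (w * u) (trans (*-congˡ x≈)
    (solve 4 (λ w y p u → w :* (y :+ p :* u) := w :* y :+ p :* (w :* u)) refl w y (q ^ k) u))

  ≈[]-* : ∀ {k x y x′ y′} → x ≈ y [q^ k ] → x′ ≈ y′ [q^ k ] → x * x′ ≈ y * y′ [q^ k ]
  ≈[]-* {x = x} {y} {x′} {y′} x≈y x′≈y′ = ≈[]-trans (≈[]-*ˡ x x′≈y′)
    (≈[]-trans (≈⇒≈[] (*-comm x y′)) (≈[]-trans (≈[]-*ˡ y′ x≈y) (≈⇒≈[] (*-comm y′ y))))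

  ≈[]-weaken : ∀ {j k x y} → j ≤ k → x ≈ y [q^ k ] → x ≈ y [q^ j ]
  ≈[]-weaken {j} {k} {x} {y} j≤k (by u x≈) = by (q ^ (k ℕ.∸ j) * u) (begin
    x                                  ≈⟨ x≈ ⟩
    y + q ^ k * u                      ≡⟨ ≡.cong (λ i → y + q ^ i * u) (≡.sym (ℕₚ.m+[n∸m]≡n j≤k)) ⟩
    y + q ^ (j ℕ.+ (k ℕ.∸ j)) * u      ≈⟨ +-congˡ (trans (*-congʳ (^-homo-* q j (k ℕ.∸ j))) (*-assoc _ _ _)) ⟩
    y + q ^ j * (q ^ (k ℕ.∸ j) * u)    ∎)

  -- The factor q^e raises the modulus by e, unlike multiplication by a general element.
  ≈[]-shift : ∀ {k x y} e → x ≈ y [q^ k ] → q ^ e * x ≈ q ^ e * y [q^ e ℕ.+ k ]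
  ≈[]-shift {k} {x} {y} e (by u x≈) = by u (begin
    q ^ e * x                          ≈⟨ trans (*-congˡ x≈) (distribˡ _ _ _) ⟩
    q ^ e * y + q ^ e * (q ^ k * u)    ≈⟨ +-congˡ (sym (trans (*-congʳ (^-homo-* q e k)) (*-assoc _ _ _))) ⟩
    q ^ e * y + q ^ (e ℕ.+ k) * u      ∎)

  ∑-cong-≈[] : ∀ {k} n {f g} → (∀ i → i < n → f i ≈ g i [q^ k ]) → ∑ n f ≈ ∑ n g [q^ k ]
  ∑-cong-≈[] zero    f≈g = ≈⇒≈[] refl
  ∑-cong-≈[] (suc n) f≈g = ≈[]-+ (∑-cong-≈[] n (λ i i<n → f≈g i (ℕₚ.m<n⇒m<1+n i<n))) (f≈g n (ℕₚ.n<1+n n))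

  -- Every exponent in the product is at least `e`, so each factor is 1 modulo q^k.
  poch≈1 : ∀ {k} e M n → k ≤ e → poch e M n ≈ 1# [q^ k ]
  poch≈1 e M zero    k≤e = ≈⇒≈[] refl
  poch≈1 e M (suc n) k≤e = ≈[]-trans
    (≈[]-* (poch≈1 e M n k≤e)
           (≈[]-weaken (ℕₚ.m≤n⇒m≤n+o (M ℕ.* n) k≤e)
             (by (- 1#) (+-congˡ (sym (trans (*-comm _ _) (-1*x≈-x _)))))))
    (≈⇒≈[] (*-identityˡ 1#))

  poch-truncate : ∀ {M} m n → 1 ≤ M → poch M M (m ℕ.+ n) ≈ poch M M m [q^ suc m ]
  poch-truncate {M} m n 1≤M = ≈[]-trans (≈⇒≈[] (poch-+ M m n))
    (≈[]-trans (≈[]-*ˡ _ (poch≈1 _ M n (n≤m*n (suc m) 1≤M))) (≈⇒≈[] (*-identityʳ _)))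

  -- The left side equals (Q^(r+1); Q)_s (Q^(s+1); Q)_r for Q = q^M, where every exponent is at
  -- least k.
  poch*qbinom≈1 : ∀ {k M} s r → 1 ≤ M → k ≤ suc s → k ≤ suc r →
    poch M M (s ℕ.+ r) * qbinom M (s ℕ.+ r) s ≈ 1# [q^ k ]
  poch*qbinom≈1 {k} {M} s r 1≤M k≤s k≤r = ≈[]-trans
    (≈⇒≈[] (begin
      poch M M (s ℕ.+ r) * qbinom M (s ℕ.+ r) s
        ≈⟨ *-congʳ (poch-+ M s r) ⟩
      poch M M s * poch (M ℕ.* suc s) M r * qbinom M (s ℕ.+ r) s
        ≈⟨ solve 3 (λ a b c → a :* b :* c := (a :* c) :* b) refl _ _ _ ⟩
      poch M M s * qbinom M (s ℕ.+ r) s * poch (M ℕ.* suc s) M r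
        ≈⟨ *-congʳ (poch*qbinom M s r) ⟩
      poch (M ℕ.* suc r) M s * poch (M ℕ.* suc s) M r ∎))
    (≈[]-trans
      (≈[]-* (poch≈1 _ M s (ℕₚ.≤-trans k≤r (n≤m*n (suc r) 1≤M)))
             (poch≈1 _ M r (ℕₚ.≤-trans k≤s (n≤m*n (suc s) 1≤M))))
      (≈⇒≈[] (*-identityˡ 1#)))

  -- The triple product and the truncated theta series

  Θ : ℕ → ℕ → ℕ → Carrier
  Θ a b n = ∑ (suc (n ℕ.+ n)) (λ s → sgn n s * q ^ θ-exp a b n s)

  tripleProduct : ℕ → ℕ → ℕ → Carrier
  tripleProduct a b n = poch (a ℕ.+ b) (a ℕ.+ b) n * (poch a (a ℕ.+ b) n * poch b (a ℕ.+ b) n)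

  -- After (Q; Q)_n is lengthened to (Q; Q)_2n, the coefficient at k is 1 modulo q^(n - |k| + 1),
  -- and the accompanying power of q supplies the missing |k|.
  triple-product≈Θ : ∀ {a b} n → 1 ≤ a → 1 ≤ b → tripleProduct a b n ≈ Θ a b n [q^ suc n ]
  triple-product≈Θ {a} {b} n 1≤a 1≤b = ≈[]-trans
    (≈[]-* (≈[]-sym (poch-truncate n n 1≤M)) (≈⇒≈[] (finite-triple-product a b n n)))
    (≈[]-trans (≈⇒≈[] (∑-*ˡ (suc (n ℕ.+ n)) _ _)) (∑-cong-≈[] (suc (n ℕ.+ n)) term))
    where
    M = a ℕ.+ b
    1≤M : 1 ≤ M
    1≤M = ℕₚ.m≤n⇒m≤n+o b 1≤a
    term : ∀ s → s < suc (n ℕ.+ n) →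
      poch M M (n ℕ.+ n) * (sgn n s * q ^ θ-exp a b n s * qbinom M (n ℕ.+ n) s)
        ≈ sgn n s * q ^ θ-exp a b n s [q^ suc n ]
    term s (s≤s s≤2n) = ≈[]-trans
      (≈⇒≈[] (solve 4 (λ p i x b → p :* (i :* x :* b) := i :* (x :* (p :* b))) refl _ _ _ _))
      (≈[]-*ˡ (sgn n s)
        (≈[]-trans
          -- `suc n ∸ e` is the modulus still needed once q^e is taken into account; for large `e`
          -- it is 0, where the congruence is trivial.
          (≈[]-weaken (ℕₚ.m≤n+m∸n (suc n) e) (≈[]-shift e
            (≡.subst (λ N → poch M M N * qbinom M N s ≈ 1# [q^ suc n ℕ.∸ e ]) s+r≡2n
              (poch*qbinom≈1 s r 1≤M
                (ℕₚ.m≤n+o⇒m∸n≤o (suc n) e bound₁) (ℕₚ.m≤n+o⇒m∸n≤o (suc n) e bound₂)))))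
          (≈⇒≈[] (*-identityʳ _))))
      where
      e = θ-exp a b n s
      r = n ℕ.+ n ℕ.∸ s
      s+r≡2n : s ℕ.+ r ≡ n ℕ.+ n
      s+r≡2n = ℕₚ.m+[n∸m]≡n s≤2n
      bound₁ : suc n ≤ e ℕ.+ suc s
      bound₁ = ≡.subst (suc n ≤_) (≡.sym (ℕₚ.+-suc e s)) (s≤s (θ-exp-lower 1≤b n s))
      lemma : ∀ e n r → e ℕ.+ n ℕ.+ r ≡ n ℕ.+ (e ℕ.+ r)
      lemma = solve-∀
      bound₂ : suc n ≤ e ℕ.+ suc r
      bound₂ = ≡.subst (suc n ≤_) (≡.sym (ℕₚ.+-suc e r)) (s≤s (ℕₚ.+-cancelˡ-≤ n n (e ℕ.+ r)
        (≡.subst₂ _≤_ s+r≡2n (lemma e n r) (ℕₚ.+-monoˡ-≤ r (θ-exp-upper 1≤a n s)))))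

  -- Trisection of the pentagonal series and the three-term relation

  sgn-zeroʳ : ∀ n → sgn n 0 ≡ ε n
  sgn-zeroʳ zero    = ≡.refl
  sgn-zeroʳ (suc n) = ≡.refl

  sgn-sucʳ : ∀ n s → sgn n (suc s) ≈ - 1# * sgn n s
  sgn-sucʳ zero    s       = refl
  sgn-sucʳ (suc n) zero    = trans (reflexive (sgn-zeroʳ n)) (sym (-1*-1* (ε n)))
  sgn-sucʳ (suc n) (suc s) = sgn-sucʳ n s

  -- n and 3n have the same parity.
  ε-triple : ∀ n → ε (triple n) ≈ ε n
  ε-triple zero    = refl
  ε-triple (suc n) = *-congˡ (trans (-1*-1* _) (ε-triple n))

  sgn-triple : ∀ n s → sgn (triple n) (triple s) ≈ sgn n s
  sgn-triple zero    s       = ε-triple s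
  sgn-triple (suc n) zero    = ε-triple (suc n)
  sgn-triple (suc n) (suc s) = sgn-triple n s

  ∑-triple : ∀ n f →
    ∑ (triple n) f ≈ ∑ n (λ k → f (triple k) + f (suc (triple k)) + f (suc (suc (triple k))))
  ∑-triple zero    f = refl
  ∑-triple (suc n) f = trans
    (solve 4 (λ a b c d → a :+ b :+ c :+ d := a :+ (b :+ c :+ d)) refl _ _ _ _)
    (+-congʳ (∑-triple n f))

  -- Splitting k = 3m - 1, 3m, 3m + 1 in the pentagonal number series.
  Θ-trisection : ∀ n → Θ 12 15 n ≈ Θ 1 2 (suc (triple n)) + (q ^ 1 * Θ 21 6 n + q ^ 2 * Θ 3 24 n)
  Θ-trisection n = sym (begin
    ∑ (suc (suc (triple n) ℕ.+ suc (triple n))) f + (q ^ 1 * Θ 21 6 n + q ^ 2 * Θ 3 24 n)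
      ≡⟨ ≡.cong (λ N → ∑ N f + (q ^ 1 * Θ 21 6 n + q ^ 2 * Θ 3 24 n)) (triple-double n) ⟩
    ∑ (triple N) f + (q ^ 1 * Θ 21 6 n + q ^ 2 * Θ 3 24 n)
      ≈⟨ +-cong (∑-triple N f) (trans (+-cong (∑-*ˡ N _ _) (∑-*ˡ N _ _)) (sym (∑-+ N _ _))) ⟩
    _ ≈⟨ sym (∑-+ N _ _) ⟩
    _ ≈⟨ ∑-cong N term ⟩
    Θ 12 15 n ∎)
    where
    N = suc (n ℕ.+ n)
    f : ℕ → Carrier
    f s = sgn (suc (triple n)) s * q ^ θ-exp 1 2 (suc (triple n)) s
    cancel : ∀ x → - 1# * x + x ≈ 0#
    cancel x = trans (+-congʳ (-1*x≈-x x)) (-‿inverseˡ x)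
    term : ∀ k →
      f (triple k) + f (suc (triple k)) + f (suc (suc (triple k)))
        + (q ^ 1 * (sgn n k * q ^ θ-exp 21 6 n k) + q ^ 2 * (sgn n k * q ^ θ-exp 3 24 n k))
      ≈ sgn n k * q ^ θ-exp 12 15 n k
    term k = begin
      f (triple k) + f (suc (triple k)) + f (suc (suc (triple k))) + (b + c′)
        -- With m = k - n, the terms at 3m - 1 and 3m + 1 have the sign opposite to (-1)^m and
        -- cancel the two shifted theta terms; only the one at 3m is left.
        ≈⟨ +-congʳ (+-cong (+-cong (shifted (trans (sgn-suc (triple n) (triple k)) (*-congˡ (sgn-triple n k)))
                                            2 (θ-exp 3 24 n k) (θ-exp-3k n k))
                                   (*-cong (sgn-triple n k) (^-congʳ q (θ-exp-3k+1 n k))))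
                           (shifted (trans (sgn-sucʳ (triple n) (triple k)) (*-congˡ (sgn-triple n k)))
                                    1 (θ-exp 21 6 n k) (θ-exp-3k+2 n k))) ⟩
      - 1# * c′ + a + - 1# * b + (b + c′)
        ≈⟨ solve 4 (λ i a b c → i :* c :+ a :+ i :* b :+ (b :+ c) := a :+ ((i :* b :+ b) :+ (i :* c :+ c))) refl
             (- 1#) a b c′ ⟩
      a + ((- 1# * b + b) + (- 1# * c′ + c′))
        ≈⟨ +-congˡ (trans (+-cong (cancel b) (cancel c′)) (+-identityˡ 0#)) ⟩
      a + 0#
        ≈⟨ +-identityʳ a ⟩
      a ∎
      where
      a = sgn n k * q ^ θ-exp 12 15 n k
      b = q ^ 1 * (sgn n k * q ^ θ-exp 21 6 n k)
      c′ = q ^ 2 * (sgn n k * q ^ θ-exp 3 24 n k)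
      shifted : ∀ {σ} → σ ≈ - 1# * sgn n k → ∀ i e {e′} → e′ ≡ i ℕ.+ e →
        σ * q ^ e′ ≈ - 1# * (q ^ i * (sgn n k * q ^ e))
      shifted σ≈ i e e′≡ = trans
        (*-cong σ≈ (trans (^-congʳ q e′≡) (^-homo-* q i e)))
        (solve 4 (λ m s x y → m :* s :* (x :* y) := m :* (x :* (s :* y))) refl
          (- 1#) (sgn n k) (q ^ i) (q ^ e))

  -- The exponents congruent to 1, 2 and 0 modulo 3 together run through 1, ..., 3n.
  tripleProduct-euler : ∀ n → tripleProduct 1 2 n ≈ poch 1 1 (triple n)
  tripleProduct-euler zero    = trans (*-identityˡ _) (*-identityˡ 1#)
  tripleProduct-euler (suc n) = begin
    (poch 3 3 n * (1# - q ^ (3 ℕ.+ 3 ℕ.* n)))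
      * (poch 1 3 n * (1# - q ^ (1 ℕ.+ 3 ℕ.* n)) * (poch 2 3 n * (1# - q ^ (2 ℕ.+ 3 ℕ.* n))))
      ≈⟨ solve 6 (λ p x r y s z → (p :* x) :* ((r :* y) :* (s :* z)) := (p :* (r :* s)) :* y :* z :* x) refl
           _ _ _ _ _ _ ⟩
    tripleProduct 1 2 n * (1# - q ^ (1 ℕ.+ 3 ℕ.* n)) * (1# - q ^ (2 ℕ.+ 3 ℕ.* n)) * (1# - q ^ (3 ℕ.+ 3 ℕ.* n))
      ≈⟨ *-cong (*-cong (*-cong (tripleProduct-euler n) (exponent 1)) (exponent 2)) (exponent 3) ⟩
    poch 1 1 (triple (suc n)) ∎
    where
    exponent : ∀ i → 1# - q ^ (i ℕ.+ 3 ℕ.* n) ≈ 1# - q ^ (i ℕ.+ 1 ℕ.* triple n)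
    exponent i = factor-cong (≡.cong (i ℕ.+_)
      (≡.trans (≡.sym (triple≡3* n)) (≡.sym (ℕₚ.*-identityˡ (triple n)))))

  -- The three-term relation between the partition generating functions, here
  -- truncated, is Θ-trisection divided by Euler's product.
  three-term-relation : ∀ {A B C} L K P → L ≤ K →
    P * poch 1 1 K ≈ 1# →
    A * poch 1 1 K ≈ tripleProduct 12 15 L →
    B * poch 1 1 K ≈ tripleProduct 21 6 L →
    C * poch 1 1 K ≈ tripleProduct 3 24 L →
    A ≈ 1# + (q ^ 1 * B + q ^ 2 * C) [q^ suc L ]
  three-term-relation {A} {B} {C} L K P L≤K PE≈1 AE BE CE =
    ≈[]-trans (≈⇒≈[] (sym (undo A)))
      (≈[]-trans (≈[]-*ˡ P relation) (≈⇒≈[] (undo _)))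
    where
    E = poch 1 1 K
    undo : ∀ x → P * (x * E) ≈ x
    undo x = begin
      P * (x * E)  ≈⟨ solve 3 (λ p x e → p :* (x :* e) := x :* (p :* e)) refl P x E ⟩
      x * (P * E)  ≈⟨ trans (*-congˡ PE≈1) (*-identityʳ x) ⟩
      x            ∎
    truncated : ∀ {m} → L ≤ m → poch 1 1 m ≈ poch 1 1 L [q^ suc L ]
    truncated {m} L≤m = ≡.subst (λ k → poch 1 1 k ≈ poch 1 1 L [q^ suc L ])
      (ℕₚ.m+[n∸m]≡n L≤m) (poch-truncate L (m ℕ.∸ L) ℕₚ.≤-refl)
    n≤triple : ∀ n → n ≤ triple n
    n≤triple n = ≡.subst (n ≤_) (≡.sym (triple≡3* n)) (n≤m*n {3} n (s≤s z≤n))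
    L≤1+3L : L ≤ suc (triple L)
    L≤1+3L = ℕₚ.m≤n⇒m≤1+n (n≤triple L)
    -- The trisection produces the pentagonal series with centre 3L + 1, whose Euler product has
    -- length 3(3L + 1). This product and `E` both agree with the one of length L modulo q^(L+1).
    euler : Θ 1 2 (suc (triple L)) ≈ E [q^ suc L ]
    euler =
      ≈[]-trans (≈[]-weaken (s≤s L≤1+3L) (≈[]-sym (triple-product≈Θ (suc (triple L)) (s≤s z≤n) (s≤s z≤n))))
      (≈[]-trans (≈⇒≈[] (tripleProduct-euler (suc (triple L))))
      (≈[]-trans (truncated (ℕₚ.≤-trans L≤1+3L (n≤triple (suc (triple L)))))
                 (≈[]-sym (truncated L≤K))))
    theta : ∀ {a b X} → 1 ≤ a → 1 ≤ b → X * E ≈ tripleProduct a b L → X * E ≈ Θ a b L [q^ suc L ]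
    theta 1≤a 1≤b XE = ≈[]-trans (≈⇒≈[] XE) (triple-product≈Θ L 1≤a 1≤b)
    relation : A * E ≈ (1# + (q ^ 1 * B + q ^ 2 * C)) * E [q^ suc L ]
    relation =
      ≈[]-trans (theta (s≤s z≤n) (s≤s z≤n) AE)
      (≈[]-trans (≈⇒≈[] (Θ-trisection L))
      (≈[]-trans
        (≈[]-+ euler (≈[]-+ (≈[]-*ˡ (q ^ 1) (≈[]-sym (theta (s≤s z≤n) (s≤s z≤n) BE)))
                            (≈[]-*ˡ (q ^ 2) (≈[]-sym (theta (s≤s z≤n) (s≤s z≤n) CE)))))
        (≈⇒≈[] (solve 5 (λ e x b y c →
            e :+ (x :* (b :* e) :+ y :* (c :* e)) := (con 1 :+ (x :* b :+ y :* c)) :* e) refl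
          E (q ^ 1) B (q ^ 2) C))))

  -- Products over the excluded parts

  excl : (ℕ → Bool) → ℕ → ℕ → Carrier
  excl p m zero    = 1#
  excl p m (suc k) = if p (suc k) then excl p m k else excl p m k * (1# - q ^ (suc k ℕ.+ m))

  -- By periodicity the factors past `m` are tested as if counted from 0; the offset in `excl` keeps
  -- their exponents right.
  excl-+ : ∀ p m → (∀ i → p (i ℕ.+ m) ≡ p i) → ∀ k → excl p 0 (k ℕ.+ m) ≈ excl p 0 m * excl p m k
  excl-+ p m periodic zero    = sym (*-identityʳ _)
  excl-+ p m periodic (suc k) rewrite periodic (suc k) with p (suc k)
  ... | true  = excl-+ p m periodic k
  ... | false = trans
    (*-cong (excl-+ p m periodic k) (factor-cong (ℕₚ.+-identityʳ (suc k ℕ.+ m))))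
    (*-assoc _ _ _)

  -- Each period of length a + b adds one factor to each of the three products.
  excl-tripleProduct : ∀ {a b} p → (∀ m i → p (i ℕ.+ m ℕ.* (a ℕ.+ b)) ≡ p i) →
    (∀ m → excl p m (a ℕ.+ b) ≈ (1# - q ^ (a ℕ.+ m)) * (1# - q ^ (b ℕ.+ m)) * (1# - q ^ (a ℕ.+ b ℕ.+ m))) →
    ∀ L → excl p 0 (L ℕ.* (a ℕ.+ b)) ≈ tripleProduct a b L
  excl-tripleProduct p periodic block zero = sym (trans (*-identityˡ _) (*-identityˡ 1#))
  excl-tripleProduct {a} {b} p periodic block (suc L) = begin
    excl p 0 (M ℕ.+ L ℕ.* M)
      ≈⟨ excl-+ p (L ℕ.* M) (periodic L) M ⟩
    excl p 0 (L ℕ.* M) * excl p (L ℕ.* M) M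
      ≈⟨ *-cong (excl-tripleProduct p periodic block L) (block (L ℕ.* M)) ⟩
    tripleProduct a b L * ((1# - q ^ (a ℕ.+ L ℕ.* M)) * (1# - q ^ (b ℕ.+ L ℕ.* M)) * (1# - q ^ (M ℕ.+ L ℕ.* M)))
      ≡⟨ ≡.cong (λ m → tripleProduct a b L * ((1# - q ^ (a ℕ.+ m)) * (1# - q ^ (b ℕ.+ m)) * (1# - q ^ (M ℕ.+ m))))
           (ℕₚ.*-comm L M) ⟩
    tripleProduct a b L * ((1# - q ^ (a ℕ.+ M ℕ.* L)) * (1# - q ^ (b ℕ.+ M ℕ.* L)) * (1# - q ^ (M ℕ.+ M ℕ.* L)))
      ≈⟨ solve 6 (λ p x r y s z → (p :* (r :* s)) :* (y :* z :* x) := (p :* x) :* ((r :* y) :* (s :* z))) refl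
           (poch M M L) (1# - q ^ (M ℕ.+ M ℕ.* L)) (poch a M L) (1# - q ^ (a ℕ.+ M ℕ.* L))
           (poch b M L) (1# - q ^ (b ℕ.+ M ℕ.* L)) ⟩
    tripleProduct a b (suc L) ∎
    where M = a ℕ.+ b

  -- For an allowed part the recurrence reads (1 - q^(k+1)) P(k+1) = P(k), which absorbs the new
  -- Euler factor; for an excluded part P is unchanged and the factor survives.
  *poch≈excl : ∀ p (P : ℕ → Carrier) → P 0 ≈ 1# →
    (∀ k → P (suc k) ≈ P k + (if p (suc k) then q ^ suc k * P (suc k) else 0#)) →
    ∀ k → P k * poch 1 1 k ≈ excl p 0 k
  *poch≈excl p P P0 P-suc zero    = trans (*-identityʳ _) P0
  *poch≈excl p P P0 P-suc (suc k) with p (suc k) | P-suc k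
  ... | true | recurrence = begin
    P (suc k) * (poch 1 1 k * (1# - q ^ (1 ℕ.+ 1 ℕ.* k)))
      ≈⟨ *-congˡ (*-congˡ (factor-cong (≡.cong suc (ℕₚ.*-identityˡ k)))) ⟩
    P (suc k) * (poch 1 1 k * (1# - x))
      ≈⟨ solve 3 (λ r e n → r :* (e :* (con 1 :+ n)) := (r :+ r :* n) :* e) refl
           (P (suc k)) (poch 1 1 k) (- x) ⟩
    (P (suc k) + P (suc k) * - x) * poch 1 1 k
      ≈⟨ *-congʳ (+-cong recurrence (trans (sym (-‿distribʳ-* _ x)) (-‿cong (*-comm _ x)))) ⟩
    (P k + x * P (suc k) + - (x * P (suc k))) * poch 1 1 k
      ≈⟨ *-congʳ (trans (+-assoc _ _ _) (trans (+-congˡ (-‿inverseʳ _)) (+-identityʳ _))) ⟩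
    P k * poch 1 1 k
      ≈⟨ *poch≈excl p P P0 P-suc k ⟩
    excl p 0 k ∎
    where x = q ^ suc k
  ... | false | recurrence = begin
    P (suc k) * (poch 1 1 k * (1# - q ^ (1 ℕ.+ 1 ℕ.* k)))
      ≈⟨ sym (*-assoc _ _ _) ⟩
    P (suc k) * poch 1 1 k * (1# - q ^ (1 ℕ.+ 1 ℕ.* k))
      ≈⟨ *-cong (trans (*-congʳ (trans recurrence (+-identityʳ _))) (*poch≈excl p P P0 P-suc k))
                (factor-cong (≡.cong suc (≡.trans (ℕₚ.*-identityˡ k) (≡.sym (ℕₚ.+-identityʳ k))))) ⟩
    excl p 0 k * (1# - q ^ (suc k ℕ.+ 0)) ∎

  -- Evaluating the test at 1, ..., 27 leaves a leading 1 and the three excluded factors.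
  block-12-15 : ∀ m → excl (allowed27 12 15 27) m 27
    ≈ (1# - q ^ (12 ℕ.+ m)) * (1# - q ^ (15 ℕ.+ m)) * (1# - q ^ (27 ℕ.+ m))
  block-12-15 m = *-congʳ (*-congʳ (*-identityˡ _))

  block-21-6 : ∀ m → excl (allowed27 6 21 27) m 27
    ≈ (1# - q ^ (21 ℕ.+ m)) * (1# - q ^ (6 ℕ.+ m)) * (1# - q ^ (27 ℕ.+ m))
  -- The factor for 6 is met before the one for 21, while the trisection yields the theta series
  -- with a = 21, hence the swap.
  block-21-6 m = *-congʳ (trans (*-congʳ (*-identityˡ _)) (*-comm _ _))

  block-3-24 : ∀ m → excl (allowed27 3 24 27) m 27
    ≈ (1# - q ^ (3 ℕ.+ m)) * (1# - q ^ (24 ℕ.+ m)) * (1# - q ^ (27 ℕ.+ m))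
  block-3-24 m = *-congʳ (*-congʳ (*-identityˡ _))

  excl-all : ∀ k → excl (λ _ → true) 0 k ≡ 1#
  excl-all zero    = ≡.refl
  excl-all (suc k) = excl-all k

-- Formal power series with integer coefficients

Series : Set
Series = ℕ → ℤ

infixl 7 _⊛_
-- The Cauchy product, computed by peeling off the constant term of the left factor.
_⊛_ : Series → Series → Series
(f ⊛ g) zero    = f 0 ℤ.* g 0
(f ⊛ g) (suc n) = f 0 ℤ.* g (suc n) ℤ.+ ((f ∘ suc) ⊛ g) n

one : Series
one zero    = 1ℤ
one (suc _) = 0ℤ

var : Series
var zero    = 0ℤ
var (suc n) = one n

⊛-cong : ∀ {f f′ g g′} → (∀ i → f i ≡ f′ i) → (∀ i → g i ≡ g′ i) → ∀ n → (f ⊛ g) n ≡ (f′ ⊛ g′) n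
⊛-cong f≡ g≡ zero    = ≡.cong₂ ℤ._*_ (f≡ 0) (g≡ 0)
⊛-cong f≡ g≡ (suc n) = ≡.cong₂ ℤ._+_ (≡.cong₂ ℤ._*_ (f≡ 0) (g≡ (suc n))) (⊛-cong (f≡ ∘ suc) g≡ n)

⊛-distribʳ : ∀ h f g n → ((λ i → f i ℤ.+ g i) ⊛ h) n ≡ (f ⊛ h) n ℤ.+ (g ⊛ h) n
⊛-distribʳ h f g zero    = ℤₚ.*-distribʳ-+ (h 0) (f 0) (g 0)
⊛-distribʳ h f g (suc n) = ≡.trans
  (≡.cong (λ z → (f 0 ℤ.+ g 0) ℤ.* h (suc n) ℤ.+ z) (⊛-distribʳ h (f ∘ suc) (g ∘ suc) n))
  (lemma (f 0) (g 0) (h (suc n)) _ _)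
  where
  lemma : ∀ a b c x y → (a ℤ.+ b) ℤ.* c ℤ.+ (x ℤ.+ y) ≡ a ℤ.* c ℤ.+ x ℤ.+ (b ℤ.* c ℤ.+ y)
  lemma = ℤ-Solver.solve-∀

⊛-scale : ∀ a f g n → ((λ i → a ℤ.* f i) ⊛ g) n ≡ a ℤ.* (f ⊛ g) n
⊛-scale a f g zero    = ℤₚ.*-assoc a (f 0) (g 0)
⊛-scale a f g (suc n) = ≡.trans
  (≡.cong (λ z → a ℤ.* f 0 ℤ.* g (suc n) ℤ.+ z) (⊛-scale a (f ∘ suc) g n))
  (lemma a (f 0) (g (suc n)) _)
  where
  lemma : ∀ a b c x → a ℤ.* b ℤ.* c ℤ.+ a ℤ.* x ≡ a ℤ.* (b ℤ.* c ℤ.+ x)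
  lemma = ℤ-Solver.solve-∀

-- The mirror image of the defining recursion, from which commutativity follows.
⊛-sucʳ : ∀ f g n → (f ⊛ g) (suc n) ≡ f (suc n) ℤ.* g 0 ℤ.+ (f ⊛ (g ∘ suc)) n
⊛-sucʳ f g zero    = ℤₚ.+-comm (f 0 ℤ.* g 1) (f 1 ℤ.* g 0)
⊛-sucʳ f g (suc n) = ≡.trans
  (≡.cong (λ z → f 0 ℤ.* g (suc (suc n)) ℤ.+ z) (⊛-sucʳ (f ∘ suc) g n))
  (lemma (f 0 ℤ.* g (suc (suc n))) (f (suc (suc n)) ℤ.* g 0) _)
  where
  lemma : ∀ a b c → a ℤ.+ (b ℤ.+ c) ≡ b ℤ.+ (a ℤ.+ c)
  lemma = ℤ-Solver.solve-∀

⊛-comm : ∀ f g n → (f ⊛ g) n ≡ (g ⊛ f) n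
⊛-comm f g zero    = ℤₚ.*-comm (f 0) (g 0)
⊛-comm f g (suc n) = ≡.trans
  (≡.cong₂ ℤ._+_ (ℤₚ.*-comm (f 0) (g (suc n))) (⊛-comm (f ∘ suc) g n))
  (≡.sym (⊛-sucʳ g f n))

⊛-assoc : ∀ f g h n → ((f ⊛ g) ⊛ h) n ≡ (f ⊛ (g ⊛ h)) n
⊛-assoc f g h zero    = ℤₚ.*-assoc (f 0) (g 0) (h 0)
⊛-assoc f g h (suc n) = begin
  f 0 ℤ.* g 0 ℤ.* h (suc n) ℤ.+ ((λ i → f 0 ℤ.* g (suc i) ℤ.+ ((f ∘ suc) ⊛ g) i) ⊛ h) n
    ≡⟨ ≡.cong (λ z → f 0 ℤ.* g 0 ℤ.* h (suc n) ℤ.+ z)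
         (⊛-distribʳ h (λ i → f 0 ℤ.* g (suc i)) ((f ∘ suc) ⊛ g) n) ⟩
  f 0 ℤ.* g 0 ℤ.* h (suc n) ℤ.+ (((λ i → f 0 ℤ.* g (suc i)) ⊛ h) n ℤ.+ (((f ∘ suc) ⊛ g) ⊛ h) n)
    ≡⟨ ≡.cong₂ (λ y z → f 0 ℤ.* g 0 ℤ.* h (suc n) ℤ.+ (y ℤ.+ z))
         (⊛-scale (f 0) (g ∘ suc) h n) (⊛-assoc (f ∘ suc) g h n) ⟩
  f 0 ℤ.* g 0 ℤ.* h (suc n) ℤ.+ (f 0 ℤ.* ((g ∘ suc) ⊛ h) n ℤ.+ ((f ∘ suc) ⊛ (g ⊛ h)) n)
    ≡⟨ lemma (f 0) (g 0) (h (suc n)) _ _ ⟩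
  f 0 ℤ.* (g 0 ℤ.* h (suc n) ℤ.+ ((g ∘ suc) ⊛ h) n) ℤ.+ ((f ∘ suc) ⊛ (g ⊛ h)) n ∎
  where
  open ≡.≡-Reasoning
  lemma : ∀ a b c x y → a ℤ.* b ℤ.* c ℤ.+ (a ℤ.* x ℤ.+ y) ≡ a ℤ.* (b ℤ.* c ℤ.+ x) ℤ.+ y
  lemma = ℤ-Solver.solve-∀

⊛-zeroˡ : ∀ f n → ((λ _ → 0ℤ) ⊛ f) n ≡ 0ℤ
⊛-zeroˡ f zero    = ≡.refl
⊛-zeroˡ f (suc n) = ≡.trans (ℤₚ.+-identityˡ _) (⊛-zeroˡ f n)

⊛-identityˡ : ∀ f n → (one ⊛ f) n ≡ f n
⊛-identityˡ f zero    = ℤₚ.*-identityˡ (f 0)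
⊛-identityˡ f (suc n) = ≡.trans
  (≡.cong₂ ℤ._+_ (ℤₚ.*-identityˡ (f (suc n))) (⊛-zeroˡ f n))
  (ℤₚ.+-identityʳ (f (suc n)))

seriesRing : CommutativeRing 0ℓ 0ℓ
seriesRing = record
  { Carrier = Series
  ; _≈_     = λ f g → ∀ n → f n ≡ g n
  ; _+_     = λ f g n → f n ℤ.+ g n
  ; _*_     = _⊛_
  ; -_      = λ f n → ℤ.- f n
  ; 0#      = λ _ → 0ℤ
  ; 1#      = one
  ; isCommutativeRing = record
    { isRing = record
      { +-isAbelianGroup = Pointwise.isAbelianGroup ℕ ℤₚ.+-0-isAbelianGroup
      ; *-cong     = ⊛-cong
      ; *-assoc    = ⊛-assoc
      ; *-identity = ⊛-identityˡ , λ f n → ≡.trans (⊛-comm f one n) (⊛-identityˡ f n)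
      ; distrib    = (λ f g h n → ≡.trans (⊛-comm f _ n) (≡.trans (⊛-distribʳ f g h n)
                       (≡.cong₂ ℤ._+_ (⊛-comm g f n) (⊛-comm h f n))))
                   , ⊛-distribʳ
      }
    ; *-comm = ⊛-comm
    }
  }

open CommutativeRing seriesRing using (semiring; _≈_; 1#) renaming (_+_ to _⊕_; _*_ to _⊗_; 0# to 0ˢ)
open import Algebra.Properties.Semiring.Exp semiring using (_^_)
open JacobiTripleProduct seriesRing var

var-⊛-suc : ∀ f n → (var ⊛ f) (suc n) ≡ f n
var-⊛-suc f n = ≡.trans (ℤₚ.+-identityˡ _) (⊛-identityˡ f n)

coeff-shift : ∀ k f n → (var ^ k ⊛ f) n ≡ (if k ≤ᵇ n then f (n ℕ.∸ k) else 0ℤ)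
coeff-shift zero          f n       = ⊛-identityˡ f n
coeff-shift (suc k)       f zero    = ≡.trans (⊛-assoc var (var ^ k) f 0) ≡.refl
-- `suc k ≤ᵇ suc n` unfolds to `k <ᵇ suc n`, which reduces only once `k` is split, so exponent 1 is
-- a case of its own.
coeff-shift (suc zero)    f (suc n) = ≡.trans (⊛-assoc var one f (suc n))
  (≡.trans (var-⊛-suc (one ⊛ f) n) (⊛-identityˡ f n))
coeff-shift (suc (suc k)) f (suc n) = ≡.trans (⊛-assoc var (var ^ suc k) f (suc n))
  (≡.trans (var-⊛-suc (var ^ suc k ⊛ f) n) (coeff-shift (suc k) f n))

≥⇒<ᵇ≡false : ∀ {m n} → n ≤ m → (m <ᵇ n) ≡ false
≥⇒<ᵇ≡false z≤n       = ≡.refl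
≥⇒<ᵇ≡false (s≤s n≤m) = ≥⇒<ᵇ≡false n≤m

-- Counting the partitions listed by partsAux

count : (ℕ → Bool) → List (List ℕ) → ℕ
count p xs = length (filter (λ λs → allAllowed p λs ≟ true) xs)

count-∷ : ∀ p x xs → count p (x ∷ xs) ≡ (if allAllowed p x then 1 else 0) ℕ.+ count p xs
count-∷ p x xs with allAllowed p x
... | true  = ≡.refl
... | false = ≡.refl

count-++ : ∀ p xs ys → count p (xs ++ ys) ≡ count p xs ℕ.+ count p ys
count-++ p xs ys = ≡.trans (≡.cong length (Listₚ.filter-++ _ xs ys)) (Listₚ.length-++ (filter _ xs))

count-concatMap : ∀ p (f : ℕ → List (List ℕ)) is →
  count p (concatMap f is) ≡ sum (List.map (λ i → count p (f i)) is)
count-concatMap p f []       = ≡.refl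
count-concatMap p f (i ∷ is) =
  ≡.trans (count-++ p (f i) (concatMap f is)) (≡.cong (count p (f i) ℕ.+_) (count-concatMap p f is))

count-map-∷ : ∀ p j xs → count p (List.map (j ∷_) xs) ≡ (if p j then count p xs else 0)
count-map-∷ p j [] with p j
... | true  = ≡.refl
... | false = ≡.refl
count-map-∷ p j (x ∷ xs)
  rewrite count-∷ p (j ∷ x) (List.map (j ∷_) xs) | count-∷ p x xs | count-map-∷ p j xs
  with p j
... | true  = ≡.refl
... | false = ≡.refl

∑↑ : ℕ → (ℕ → ℕ) → ℕ
∑↑ n f = sum (applyUpTo f n)

∑↑-cong : ∀ n {f g : ℕ → ℕ} → (∀ i → f i ≡ g i) → ∑↑ n f ≡ ∑↑ n g
∑↑-cong zero    f≡g = ≡.refl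
∑↑-cong (suc n) f≡g = ≡.cong₂ ℕ._+_ (f≡g 0) (∑↑-cong n (f≡g ∘ suc))

∑↑-zero : ∀ n → ∑↑ n (λ _ → 0) ≡ 0
∑↑-zero zero    = ≡.refl
∑↑-zero (suc n) = ∑↑-zero n

-- Raising the cutoff by one admits only the index `k`, provided it is in range; this becomes the
-- effect of allowing one more part size.
∑↑-cutoff-suc : ∀ n k (h : ℕ → ℕ) →
  ∑↑ n (λ i → if i <ᵇ suc k then h i else 0)
    ≡ ∑↑ n (λ i → if i <ᵇ k then h i else 0) ℕ.+ (if k <ᵇ n then h k else 0)
∑↑-cutoff-suc zero    k       h = ≡.refl
∑↑-cutoff-suc (suc n) zero    h = ℕₚ.+-comm (h 0) _
∑↑-cutoff-suc (suc n) (suc k) h =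
  ≡.trans (≡.cong (h 0 ℕ.+_) (∑↑-cutoff-suc n k (h ∘ suc))) (≡.sym (ℕₚ.+-assoc (h 0) _ _))

partsCount : (ℕ → Bool) → ℕ → ℕ → ℕ → ℕ
partsCount p f k n = count p (partsAux f k n)

-- For `i ≤ n` and enough fuel, the allowed partitions of `suc n` with largest part `suc i`; the
-- remainder `suc n ∸ suc i` is `n ∸ i`.
partsCountFirst : (ℕ → Bool) → ℕ → ℕ → ℕ → ℕ
partsCountFirst p f n i = if p (suc i) then partsCount p f (suc i) (n ℕ.∸ i) else 0

partsCount-suc : ∀ p f k n → partsCount p (suc f) k (suc n)
  ≡ ∑↑ (suc n) (λ i → if i <ᵇ k then partsCountFirst p f n i else 0)
partsCount-suc p f k n = begin
  count p (concatMap parts (upTo (suc n)))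
    ≡⟨ count-concatMap p parts (upTo (suc n)) ⟩
  sum (List.map (λ i → count p (parts i)) (upTo (suc n)))
    ≡⟨ ≡.cong sum (Listₚ.map-upTo (λ i → count p (parts i)) (suc n)) ⟩
  ∑↑ (suc n) (λ i → count p (parts i))
    ≡⟨ ∑↑-cong (suc n) term ⟩
  ∑↑ (suc n) (λ i → if i <ᵇ k then partsCountFirst p f n i else 0) ∎
  where
  open ≡.≡-Reasoning
  parts : ℕ → List (List ℕ)
  parts i = if suc i ≤ᵇ k then List.map (suc i ∷_) (partsAux f (suc i) (n ℕ.∸ i)) else []
  term : ∀ i → count p (parts i) ≡ (if i <ᵇ k then partsCountFirst p f n i else 0)
  term i with i <ᵇ k
  ... | true  = count-map-∷ p (suc i) (partsAux f (suc i) (n ℕ.∸ i))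
  ... | false = ≡.refl

-- Each unit of fuel spent removes a positive part, so fuel at least `n` never runs out.
partsCount-fuel : ∀ p f f′ k n → n ≤ f → n ≤ f′ → partsCount p f k n ≡ partsCount p f′ k n
partsCount-fuel p f       f′       k zero    _         _          = ≡.refl
partsCount-fuel p (suc f) (suc f′) k (suc n) (s≤s n≤f) (s≤s n≤f′) = ≡.trans (partsCount-suc p f k n)
  (≡.trans (∑↑-cong (suc n) term) (≡.sym (partsCount-suc p f′ k n)))
  where
  term : ∀ i → (if i <ᵇ k then partsCountFirst p f n i else 0) ≡ (if i <ᵇ k then partsCountFirst p f′ n i else 0)
  term i = Boolₚ.if-cong-then (i <ᵇ k) (Boolₚ.if-cong-then (p (suc i))
    (partsCount-fuel p f f′ (suc i) (n ℕ.∸ i)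
      (ℕₚ.≤-trans (ℕₚ.m∸n≤m n i) n≤f) (ℕₚ.≤-trans (ℕₚ.m∸n≤m n i) n≤f′)))

partitionCount : (ℕ → Bool) → ℕ → ℕ → ℕ
partitionCount p k n = partsCount p n k n

-- Either no part equals `suc k`, or one copy of it is removed. In coefficients this is the
-- recurrence that `*poch≈excl` expects.
partitionCount-suc : ∀ p k n → partitionCount p (suc k) n
  ≡ partitionCount p k n ℕ.+ (if k <ᵇ n then (if p (suc k) then partitionCount p (suc k) (n ℕ.∸ suc k) else 0) else 0)
partitionCount-suc p k zero    = ≡.refl
partitionCount-suc p k (suc n) = ≡.trans (partsCount-suc p n (suc k) n)
  (≡.trans (∑↑-cutoff-suc (suc n) k (partsCountFirst p n n))
    (≡.cong₂ ℕ._+_ (≡.sym (partsCount-suc p n k n))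
      (Boolₚ.if-cong-then (k <ᵇ suc n) (Boolₚ.if-cong-then (p (suc k))
        -- The remainder is counted with fuel `n`, while `partitionCount` takes the size itself as
        -- fuel.
        (partsCount-fuel p n (n ℕ.∸ k) (suc k) (n ℕ.∸ k) (ℕₚ.m∸n≤m n k) ℕₚ.≤-refl)))))

-- No part of a partition of n exceeds n. Hence one common bound on the parts serves all three
-- series.
partitionCount-stable : ∀ p n d → partitionCount p (d ℕ.+ n) n ≡ partitionCount p n n
partitionCount-stable p n zero    = ≡.refl
partitionCount-stable p n (suc d) = ≡.trans (partitionCount-suc p (d ℕ.+ n) n)
  (≡.trans (≡.cong (partitionCount p (d ℕ.+ n) n ℕ.+_) (Boolₚ.if-cong (≥⇒<ᵇ≡false (ℕₚ.m≤n+m n d))))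
    (≡.trans (ℕₚ.+-identityʳ _) (partitionCount-stable p n d)))

partitionSeries : (ℕ → Bool) → ℕ → Series
partitionSeries p k n = + partitionCount p k n

partitionSeries-zero : ∀ p n → partitionSeries p 0 n ≡ one n
partitionSeries-zero p zero    = ≡.refl
partitionSeries-zero p (suc n) = ≡.cong +_ (≡.trans (partsCount-suc p n 0 n) (∑↑-zero (suc n)))

partitionSeries-suc : ∀ p k → partitionSeries p (suc k)
  ≈ partitionSeries p k ⊕ (if p (suc k) then var ^ suc k ⊗ partitionSeries p (suc k) else 0ˢ)
partitionSeries-suc p k n = ≡.trans (≡.cong +_ (partitionCount-suc p k n))
  (≡.trans (ℤₚ.pos-+ (partitionCount p k n) _) (≡.cong (λ z → partitionSeries p k n ℤ.+ z) new))
  where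
  new : + (if k <ᵇ n then (if p (suc k) then partitionCount p (suc k) (n ℕ.∸ suc k) else 0) else 0)
    ≡ (if p (suc k) then var ^ suc k ⊗ partitionSeries p (suc k) else 0ˢ) n
  new with p (suc k)
  ... | true  = ≡.trans (Boolₚ.if-float +_ (k <ᵇ n)) (≡.sym (coeff-shift (suc k) (partitionSeries p (suc k)) n))
  ... | false with k <ᵇ n
  ...   | true  = ≡.refl
  ...   | false = ≡.refl

partitionSeries*poch : ∀ p k → partitionSeries p k ⊗ poch 1 1 k ≈ excl p 0 k
partitionSeries*poch p =
  *poch≈excl p (partitionSeries p) (partitionSeries-zero p) (partitionSeries-suc p)

-- Generating functions modulo 27 and their coefficients

allowed27-periodic : ∀ a b c m i → allowed27 a b c (i ℕ.+ m ℕ.* 27) ≡ allowed27 a b c i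
allowed27-periodic a b c m i =
  ≡.cong (λ r → not ((r ≡ᵇ a % 27) ∨ (r ≡ᵇ b % 27) ∨ (r ≡ᵇ c % 27))) ([m+kn]%n≡m%n i m 27)

p27-coefficient : ∀ a b c {n k} → n ≤ k → partitionSeries (allowed27 a b c) k n ≡ + p27 n a b c
p27-coefficient a b c {n} {k} n≤k = ≡.cong +_ (≡.trans
  (≡.cong (λ j → partitionCount (allowed27 a b c) j n) (≡.sym (ℕₚ.m∸n+n≡m n≤k)))
  (partitionCount-stable (allowed27 a b c) n (k ℕ.∸ n)))

-- Bounding the parts by 27 L covers L whole periods, so each product of excluded factors is exactly
-- a finite triple product of length L.
generating-functions : ∀ L → let K = L ℕ.* 27 in
  partitionSeries (allowed27 12 15 27) K
    ≈ 1# ⊕ (var ^ 1 ⊗ partitionSeries (allowed27 6 21 27) K ⊕ var ^ 2 ⊗ partitionSeries (allowed27 3 24 27) K)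
    [q^ suc L ]
generating-functions L = three-term-relation L (L ℕ.* 27) (partitionSeries (λ _ → true) (L ℕ.* 27))
  (ℕₚ.m≤m*n L 27)
  -- With no part excluded the remaining product is empty, so this series inverts Euler's product.
  (λ n → ≡.trans (partitionSeries*poch (λ _ → true) (L ℕ.* 27) n) (≡.cong (λ f → f n) (excl-all (L ℕ.* 27))))
  (λ n → ≡.trans (partitionSeries*poch (allowed27 12 15 27) (L ℕ.* 27) n)
    (excl-tripleProduct {12} {15} (allowed27 12 15 27) (allowed27-periodic 12 15 27) block-12-15 L n))
  (λ n → ≡.trans (partitionSeries*poch (allowed27 6 21 27) (L ℕ.* 27) n)
    (excl-tripleProduct {21} {6} (allowed27 6 21 27) (allowed27-periodic 6 21 27) block-21-6 L n))
  (λ n → ≡.trans (partitionSeries*poch (allowed27 3 24 27) (L ℕ.* 27) n)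
    (excl-tripleProduct {3} {24} (allowed27 3 24 27) (allowed27-periodic 3 24 27) block-3-24 L n))

coefficient-relation : ∀ {A B C : Series} n → 2 ≤ n →
  A ≈ 1# ⊕ (var ^ 1 ⊗ B ⊕ var ^ 2 ⊗ C) [q^ suc n ] → A n ≡ B (n ℕ.∸ 1) ℤ.+ C (n ℕ.∸ 2)
coefficient-relation {A} {B} {C} n@(suc (suc m)) (s≤s (s≤s z≤n)) (by z equality) = begin
  A n
    ≡⟨ equality n ⟩
  0ℤ ℤ.+ ((var ^ 1 ⊗ B) n ℤ.+ (var ^ 2 ⊗ C) n) ℤ.+ (var ^ suc n ⊗ z) n
    -- The constant series 1 has coefficient 0 at n ≥ 2, and the error term is a multiple of
    -- q^(n+1).
    ≡⟨ ≡.cong₂ ℤ._+_ (≡.trans (ℤₚ.+-identityˡ _) (≡.cong₂ ℤ._+_ (coeff-shift 1 B n) (coeff-shift 2 C n)))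
         (≡.trans (coeff-shift (suc n) z n) (Boolₚ.if-cong (≥⇒<ᵇ≡false (ℕₚ.≤-refl {n})))) ⟩
  B (suc m) ℤ.+ C m ℤ.+ 0ℤ
    ≡⟨ ℤₚ.+-identityʳ _ ⟩
  B (suc m) ℤ.+ C m ∎
  where open ≡.≡-Reasoning

open import Data.Nat using (_+_; _∸_)

theorem1 : (n : ℕ) → 2 ≤ n →
    p27 n 12 15 27 ≡ p27 (n ∸ 1) 6 21 27 + p27 (n ∸ 2) 3 24 27
theorem1 n 2≤n = ℤₚ.+-injective (begin
  + p27 n 12 15 27
    ≡⟨ ≡.sym (p27-coefficient 12 15 27 n≤K) ⟩
  partitionSeries (allowed27 12 15 27) K n
    -- The choice L = n makes the modulus q^(n+1), just enough to compare coefficients at n.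
    ≡⟨ coefficient-relation n 2≤n (generating-functions n) ⟩
  partitionSeries (allowed27 6 21 27) K (n ∸ 1) ℤ.+ partitionSeries (allowed27 3 24 27) K (n ∸ 2)
    ≡⟨ ≡.cong₂ ℤ._+_ (p27-coefficient 6 21 27 (ℕₚ.≤-trans (ℕₚ.m∸n≤m n 1) n≤K))
                     (p27-coefficient 3 24 27 (ℕₚ.≤-trans (ℕₚ.m∸n≤m n 2) n≤K)) ⟩
  + p27 (n ∸ 1) 6 21 27 ℤ.+ + p27 (n ∸ 2) 3 24 27
    ≡⟨ ≡.sym (ℤₚ.pos-+ (p27 (n ∸ 1) 6 21 27) (p27 (n ∸ 2) 3 24 27)) ⟩
  + (p27 (n ∸ 1) 6 21 27 + p27 (n ∸ 2) 3 24 27) ∎)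
  where
  open ≡.≡-Reasoning
  K = n ℕ.* 27
  n≤K : n ≤ K
  n≤K = ℕₚ.m≤m*n n 27
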